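{- If $H$ is an intersecting $5$-segment hypergraph, then $\tau(H) \le 3$.
   Context: A hypergraph $H=(V,E)$ consists of a vertex set $V$ and an edge set $E \subset 2^V$. For an integer $r \ge 2$, a hypergraph $H=(V,E)$ with $V \subset \mathbb{Z}^2$ is an $r$-segment hypergraph if (i) every edge in $E$ consists of $r$ consecutive integer points (points of $\mathbb{Z}^2$) on some line in $\mathbb{R}^2$, and (ii) every line in $\mathbb{R}^2$ contains at most one edge of $H$. The matching number $\nu(H)$ is the maximum number of pairwise disjoint edges; $H$ is intersecting if $\nu(H)=1$. The covering number $\tau(H)$ is the minimum size of a set of vertices meeting every edge of $H$. -}

module Defs where

open import Data.Empty using (⊥-elim)
open import Data.Integer.Base using (ℤ; 0ℤ; _+_; _*_; _≤_)
import Data.Integer.Properties as ℤ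
open import Data.List.Base using (List; []; _∷_; length)
open import Data.List.Membership.Propositional using (find; lose)
  renaming (_∈_ to _∈ˡ_)
open import Data.List.Relation.Unary.All using (All; []; _∷_)
open import Data.List.Relation.Unary.AllPairs using (AllPairs; []; _∷_)
open import Data.List.Relation.Unary.Any using (here; any?)
open import Data.List.Relation.Unary.Unique.Propositional using (Unique)
open import Data.Nat.Base as ℕ using (ℕ; NonTrivial)
open import Data.Nat.Induction using (<-rec)
import Data.Nat.Properties as ℕ
open import Data.Product.Base using (_×_; _,_; ∃-syntax; Σ-syntax)
import Data.Product.Properties as Product
open import Data.Sum.Base using (_⊎_)
open import Level using (0ℓ; suc)
open import Relation.Binary.Definitions using (DecidableEquality)
open import Relation.Binary.PropositionalEquality using (_≡_; refl)
open import Relation.Nullary using (¬_; yes; no)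
open import Relation.Unary using (Pred; _∈_; _⊆_; _≐_; _⊥_; _≬_)

------------------------------------------------------------------------
-- Hypergraphs

-- Sets are predicates, considered up to extensional equality _≐_.
-- Neither the vertex set nor the edge set is assumed to be finite.

HasSize : ∀ {A : Set} → Pred A 0ℓ → ℕ → Set
HasSize {A} P n = Σ[ xs ∈ List A ] Unique xs × length xs ≡ n × P ≐ (_∈ˡ xs)

record Hypergraph (A : Set) : Set (suc 0ℓ) where
  field
    V     : Pred A 0ℓ
    E     : Pred (Pred A 0ℓ) 0ℓ
    E⊆2^V : ∀ e → e ∈ E → e ⊆ V

module _ {A : Set} (H : Hypergraph A) where
  open Hypergraph H

  -- Distinctness is required besides disjointness so that the length of
  -- the list is the number of edges (the empty set is disjoint from itself).
  IsMatching : List (Pred A 0ℓ) → Set₁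
  IsMatching M = All (_∈ E) M × AllPairs (λ e f → ¬ (e ≐ f) × e ⊥ f) M

  IsMatchingNumber : ℕ → Set₁
  IsMatchingNumber ν =
    (∃[ M ] IsMatching M × length M ≡ ν) ×
    (∀ M → IsMatching M → length M ℕ.≤ ν)

  Intersecting : Set₁
  Intersecting = IsMatchingNumber 1

  IsCover : Pred A 0ℓ → Set₁
  IsCover C = C ⊆ V × (∀ e → e ∈ E → C ≬ e)

  -- "τ is the covering number": the minimum size of a cover is attained
  -- and equal to τ.
  IsCoveringNumber : ℕ → Set₁
  IsCoveringNumber τ =
    (∃[ C ] IsCover C × HasSize C τ) ×
    (∀ C n → IsCover C → HasSize C n → τ ℕ.≤ n)

------------------------------------------------------------------------
-- Segment hypergraphs

Point : Set
Point = ℤ × ℤ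

-- The line a x + b y = c of ℝ².  A line through two distinct points of ℤ²
-- has such an equation with integer coefficients; other lines of ℝ² contain
-- at most one point of ℤ², hence no edge with at least two points.
record Line : Set where
  field
    a b c   : ℤ
    nonzero : ¬ (a ≡ 0ℤ × b ≡ 0ℤ)

integerPoints : Line → Pred Point 0ℓ
integerPoints ℓ (x , y) = a * x + b * y ≡ c
  where open Line ℓ

Betweenℤ : ℤ → ℤ → ℤ → Set
Betweenℤ x y z = (x ≤ y × y ≤ z) ⊎ (z ≤ y × y ≤ x)

-- For collinear p, q, s this says that q lies on the closed segment from
-- p to s.
Between : Point → Point → Point → Set
Between (x₁ , y₁) (x₂ , y₂) (x₃ , y₃) = Betweenℤ x₁ x₂ x₃ × Betweenℤ y₁ y₂ y₃

-- r consecutive integer points on ℓ: r of them, none skipped in between.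
record ConsecutiveOn (r : ℕ) (ℓ : Line) (e : Pred Point 0ℓ) : Set where
  field
    onLine  : e ⊆ integerPoints ℓ
    size    : HasSize e r
    noGaps  : ∀ p q s → p ∈ e → s ∈ e → q ∈ integerPoints ℓ →
              Between p q s → q ∈ e

record IsSegmentHypergraph (r : ℕ) .{{_ : NonTrivial r}}
                           (H : Hypergraph Point) : Set₁ where
  open Hypergraph H
  field
    consecutive    : ∀ e → e ∈ E → ∃[ ℓ ] ConsecutiveOn r ℓ e
    oneEdgePerLine : ∀ ℓ e f → e ∈ E → f ∈ E →
                     e ⊆ integerPoints ℓ → f ⊆ integerPoints ℓ → e ≐ f

------------------------------------------------------------------------
-- Intersecting segment hypergraphs have a covering number

-- Covering numbers are given by a relation; the lemmas below show that
-- hypotheses of the form IsCoveringNumber H τ are not vacuous.  The double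
-- negation is needed because E need not be decidable.

coveringNumber-exists : ∀ {A} (H : Hypergraph A) C n → IsCover H C →
                        HasSize C n → ¬ ¬ (∃[ τ ] IsCoveringNumber H τ)
coveringNumber-exists H C n cover size ¬τ = noCover n C cover size
  where
  noCover : ∀ n C → IsCover H C → ¬ HasSize C n
  noCover = <-rec _ λ n rec C cover size →
    ¬τ (n , (C , cover , size) , λ D m cover′ size′ →
      ℕ.≮⇒≥ λ m<n → rec m<n D cover′ size′)

_≟_ : DecidableEquality Point
_≟_ = Product.≡-dec ℤ._≟_ ℤ._≟_

open import Data.List.Membership.DecPropositional _≟_ using (_∈?_)

meet : ∀ {e f : Pred Point 0ℓ} {m n} → HasSize e m → HasSize f n →
       ¬ (e ⊥ f) → e ≬ f
meet (xs , _ , _ , e⊆ , ⊆e) (ys , _ , _ , f⊆ , ⊆f) ¬e⊥f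
  with any? (_∈? ys) xs
... | yes p = let x , x∈xs , x∈ys = find p in x , ⊆e x∈xs , ⊆f x∈ys
... | no ¬p = ⊥-elim (¬e⊥f λ (x∈e , x∈f) → ¬p (lose (e⊆ x∈e) (f⊆ x∈f)))

nonempty : ∀ {e : Pred Point 0ℓ} {r} .{{_ : NonTrivial r}} → HasSize e r →
           ∃[ p ] p ∈ e
nonempty (x ∷ _ , _ , _ , _ , ⊆e) = x , ⊆e (here refl)
nonempty {{()}} ([] , _ , refl , _)

edge-isCover : ∀ {r} .{{_ : NonTrivial r}} (H : Hypergraph Point) →
               IsSegmentHypergraph r H → Intersecting H →
               ∀ e → e ∈ Hypergraph.E H → IsCover H e
edge-isCover {r} H seg (_ , ν≤1) e e∈E = E⊆2^V e e∈E , λ f f∈E →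
  meet (size e e∈E) (size f f∈E) λ e⊥f →
    let p , p∈e = nonempty (size e e∈E)
        e≢f     = λ (e⊆f , _) → e⊥f (p∈e , e⊆f p∈e)
    in ℕ.1+n≰n (ν≤1 (e ∷ f ∷ [])
         (e∈E ∷ f∈E ∷ [] , ((e≢f , λ {_} → e⊥f) ∷ []) ∷ [] ∷ []))
  where
  open Hypergraph H
  size : ∀ f → f ∈ E → HasSize f r
  size f f∈E = let _ , c = IsSegmentHypergraph.consecutive seg f f∈E
               in ConsecutiveOn.size c

τ-exists : ∀ {r} .{{_ : NonTrivial r}} (H : Hypergraph Point) →
           IsSegmentHypergraph r H → Intersecting H →
           ¬ ¬ (∃[ τ ] IsCoveringNumber H τ)
τ-exists {r} H seg int@((e ∷ [] , (e∈E ∷ [] , _) , _) , _) =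
  let _ , c = IsSegmentHypergraph.consecutive seg e e∈E
  in coveringNumber-exists H e r (edge-isCover H seg int e e∈E)
       (ConsecutiveOn.size c)

{-# OPTIONS --safe #-}
-- Suppose τ > 3.  Then any three points lying on edges are missed by some
-- edge.  Missing the three inner points of an edge gives an edge through one
-- of its ends; in the affine coordinates spanned by the steps of these two
-- edges, every further edge has finitely many possible positions: it misses
-- some chosen three points covering the edges known so far, hence it meets
-- two known edges in different points, and it is one of the ten 5-term
-- progressions through these two points.  Choosing the covers suitably, all
-- branches of this search die before a sixth edge is found.  The lattice
-- enters only through the fact that edges are progressions.

module Submission where

open import Defs
open import Data.Nat.Base using (ℕ; _≤_)

open import Data.Bool.Base using (Bool; true; false; T; _∧_)
open import Data.Bool.ListAction using (all; any)
open import Data.Bool.Properties using (T?; T-∧; T-≡)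
open import Data.Empty using (⊥; ⊥-elim)
open import Data.Integer.Base as ℤ
  using (ℤ; +_; -[1+_]; -1ℤ; 0ℤ; 1ℤ; _+_; _-_; -_; _*_; ∣_∣; Positive; NonZero;
         positive; >-nonZero; ≢-nonZero; nonNegative; nonPositive; +≤+)
import Data.Integer.Properties as ℤ
open import Data.Integer.Tactic.RingSolver using (solve-∀)
open import Data.List.Base
  using (List; []; _∷_; _++_; concatMap; deduplicate; filter; filterᵇ; length; map; take; upTo)
open import Data.List.Membership.Propositional using (_∈_; _∉_; find; lose)
open import Data.List.Membership.Propositional.Properties
  using (∈-++⁺ʳ; ∈-deduplicate⁺; ∈-deduplicate⁻; ∈-filter⁺; ∈-filter⁻; ∈-map⁺; ∈-map⁻; ∈-upTo⁺; ∈-upTo⁻)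
open import Data.List.Properties using (length-deduplicate; map-cong)
open import Data.List.Relation.Binary.Permutation.Propositional using (↭-sym; ↭⇒↭ₛ)
open import Data.List.Relation.Binary.Permutation.Propositional.Properties using (∈-resp-↭; ↭-length)
import Data.List.Relation.Binary.Permutation.Setoid.Properties as Permutation
open import Data.List.Relation.Unary.All as All using (All; []; _∷_)
import Data.List.Relation.Unary.All.Properties as All
open import Data.List.Relation.Unary.AllPairs as AllPairs using (AllPairs; []; _∷_)
open import Data.List.Relation.Unary.Any as Any using (Any; any?; here; there)
open import Data.List.Relation.Unary.Any.Properties using (any⁺; any⁻)
open import Data.List.Relation.Unary.Sorted.TotalOrder.Properties using (Sorted⇒AllPairs)
import Data.List.Relation.Unary.Unique.DecPropositional.Properties as Unique
import Data.List.Sort as Sort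
open import Data.Nat.Base as ℕ using (zero; suc; z≤n; s≤s; s≤s⁻¹)
import Data.Nat.Properties as ℕ
open import Data.Product.Base using (_×_; _,_; proj₁; proj₂; ∃-syntax; uncurry)
import Data.Product.Properties as Product
open import Data.Sum.Base using (inj₁; inj₂; [_,_]′)
open import Function.Base using (_∘_; id)
open import Function.Bundles using (Equivalence)
open import Level using (0ℓ)
open import Relation.Binary.Bundles using (DecTotalOrder)
import Relation.Binary.Construct.On as On
open import Relation.Binary.Definitions using (DecidableEquality; tri<; tri≈; tri>)
open import Relation.Binary.PropositionalEquality
  using (_≡_; _≢_; refl; sym; trans; cong; cong₂; subst; subst₂; setoid)
open import Relation.Nullary using (Dec; yes; no; does; ¬_; contradiction; _×-dec_)
open import Relation.Nullary.Decidable as Dec using (decidable-stable; from-yes)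
open import Relation.Unary using (Pred; _≐_; _≬_; _⊆_) renaming (_∈_ to _∈ᵖ_)
open import Relation.Unary.Properties using (≐-trans)

-- Vector arithmetic on points

infixl 6 _⊕_ _⊖_
infixl 7 _·_

_⊕_ _⊖_ : Point → Point → Point
(x , y) ⊕ (z , w) = x + z , y + w
(x , y) ⊖ (z , w) = x - z , y - w

_·_ : ℤ → Point → Point
k · (x , y) = k * x , k * y

-- Edges carry two encodings: as predicates, and for computation as lists.
Edge : Set
Edge = List Point

-- The 5-term progression with step d in which p is the term of index i.
progression : Point → Point → ℕ → Edge
progression p d i = map (λ m → p ⊕ (+ m - + i) · d) (upTo 5)

-- Edges are progressions

IsProgression : Pred Point 0ℓ → Set
IsProgression e = ∃[ p ] ∃[ d ] d ≢ (0ℤ , 0ℤ) × e ≐ (_∈ progression p d 0)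

-- Up to the positive factor `n`, each `x` is the same affine function of its parameter `t`; the
-- sign of the slope `m` selects the alternative of `Betweenℤ`.
betweenℤ : ∀ n .{{_ : Positive n}} k m {t₁ t₂ t₃} x₁ x₂ x₃ →
           n * x₁ ≡ k + m * t₁ → n * x₂ ≡ k + m * t₂ → n * x₃ ≡ k + m * t₃ →
           t₁ ℤ.≤ t₂ → t₂ ℤ.≤ t₃ → Betweenℤ x₁ x₂ x₃
betweenℤ n k m x₁ x₂ x₃ eq₁ eq₂ eq₃ t₁≤t₂ t₂≤t₃ with ℤ.≤-total 0ℤ m
... | inj₁ 0≤m = inj₁ (monotone eq₁ eq₂ t₁≤t₂ , monotone eq₂ eq₃ t₂≤t₃)
  where
  monotone : ∀ {s t x y} → n * x ≡ k + m * s → n * y ≡ k + m * t → s ℤ.≤ t → x ℤ.≤ y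
  monotone {x = x} {y} eq eq′ s≤t = ℤ.*-cancelˡ-≤-pos x y n (subst₂ ℤ._≤_ (sym eq) (sym eq′)
    (ℤ.+-monoʳ-≤ k (ℤ.*-monoˡ-≤-nonNeg m {{nonNegative 0≤m}} s≤t)))
... | inj₂ m≤0 = inj₂ (antitone eq₂ eq₃ t₂≤t₃ , antitone eq₁ eq₂ t₁≤t₂)
  where
  antitone : ∀ {s t x y} → n * x ≡ k + m * s → n * y ≡ k + m * t → s ℤ.≤ t → y ℤ.≤ x
  antitone {x = x} {y} eq eq′ s≤t = ℤ.*-cancelˡ-≤-pos y x n (subst₂ ℤ._≤_ (sym eq′) (sym eq)
    (ℤ.+-monoʳ-≤ k (ℤ.*-monoˡ-≤-nonPos m {{nonPositive m≤0}} s≤t)))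

square : ∀ i → + (∣ i ∣ ℕ.* ∣ i ∣) ≡ i * i
square (+ n)    = ℤ.pos-* n n
square -[1+ n ] = refl

Sorted : (Point → ℤ) → List Point → Set
Sorted t = AllPairs (λ p q → t p ℤ.< t q)

sorted-gap : ∀ {t} ps {p q r rs} → Sorted t (ps ++ p ∷ q ∷ rs) →
             r ∈ ps ++ p ∷ q ∷ rs → t p ℤ.< t r → ¬ t r ℤ.< t q
sorted-gap []       _              (here refl)         p<r r<q = ℤ.<-irrefl refl p<r
sorted-gap []       _              (there (here refl)) p<r r<q = ℤ.<-irrefl refl r<q
sorted-gap []       (_ ∷ q<rs ∷ _) (there (there r∈))  p<r r<q = ℤ.<-asym r<q (All.lookup q<rs r∈)
sorted-gap (_ ∷ ps) (s<ps ∷ _)     (here refl)         p<r r<q =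
  ℤ.<-asym p<r (All.lookup s<ps (∈-++⁺ʳ ps (here refl)))
sorted-gap (_ ∷ ps) (_ ∷ sorted)   (there r∈)          p<r r<q = sorted-gap ps sorted r∈ p<r r<q

sorted-step : ∀ {t} ps {p q rs} → Sorted t (ps ++ p ∷ q ∷ rs) → t p ℤ.< t q
sorted-step []       ((p<q ∷ _) ∷ _) = p<q
sorted-step (_ ∷ ps) (_ ∷ sorted)    = sorted-step ps sorted

⊕-identityʳ : ∀ p → p ≡ p ⊕ (0ℤ , 0ℤ)
⊕-identityʳ (x , y) = cong₂ _,_ (sym (ℤ.+-identityʳ x)) (sym (ℤ.+-identityʳ y))

⊕-⊖ : ∀ p q → p ⊕ (q ⊖ p) ≡ q
⊕-⊖ (x , y) (z , w) = cong₂ _,_ (lemma x z) (lemma y w)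
  where
  lemma : ∀ x z → x + (z - x) ≡ z
  lemma = solve-∀

⊕-zero : ∀ p d i → p ⊕ (i - i) · d ≡ p
⊕-zero (x , y) (z , w) i = cong₂ _,_ (lemma i x z) (lemma i y w)
  where
  lemma : ∀ i x z → x + (i - i) * z ≡ x
  lemma = solve-∀

⊕-step : ∀ p d k → p ⊕ k · d ⊕ d ≡ p ⊕ (1ℤ + k) · d
⊕-step (x , y) (z , w) k = cong₂ _,_ (lemma k x z) (lemma k y w)
  where
  lemma : ∀ k x z → x + k * z + z ≡ x + (1ℤ + k) * z
  lemma = solve-∀

module _ (ℓ : Line) where
  open Line ℓ

  level key : Point → ℤ
  level (x , y) = a * x + b * y
  key   (x , y) = b * x - a * y

  -- The squared length of the normal vector `(a , b)`, the common denominator when a point is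
  -- recovered from its level and key.
  norm : ℕ
  norm = ∣ a ∣ ℕ.* ∣ a ∣ ℕ.+ ∣ b ∣ ℕ.* ∣ b ∣

  norm≡ : + norm ≡ a * a + b * b
  norm≡ = trans (ℤ.pos-+ (∣ a ∣ ℕ.* ∣ a ∣) (∣ b ∣ ℕ.* ∣ b ∣)) (cong₂ _+_ (square a) (square b))

  norm>0 : 0ℤ ℤ.< + norm
  norm>0 = ℤ.≤∧≢⇒< (+≤+ ℕ.z≤n) λ 0≡norm →
    let sum≡0 = sym (ℤ.+-injective 0≡norm)
    in nonzero (root a (ℕ.m+n≡0⇒m≡0 _ sum≡0) , root b (ℕ.m+n≡0⇒n≡0 _ sum≡0))
    where
    root : ∀ i → ∣ i ∣ ℕ.* ∣ i ∣ ≡ 0 → i ≡ 0ℤ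
    root i eq = ℤ.∣i∣≡0⇒i≡0 ([ id , id ]′ (ℕ.m*n≡0⇒m≡0∨n≡0 ∣ i ∣ eq))

  -- The level and the key are orthogonal coordinates: they determine the
  -- point, and along the line each coordinate is monotone in the key.
  x-from-key : ∀ p → + norm * proj₁ p ≡ a * level p + b * key p
  x-from-key (x , y) = trans (cong (_* x) norm≡) (lemma a b x y)
    where
    lemma : ∀ a b x y → (a * a + b * b) * x ≡ a * (a * x + b * y) + b * (b * x - a * y)
    lemma = solve-∀

  y-from-key : ∀ p → + norm * proj₂ p ≡ b * level p + - a * key p
  y-from-key (x , y) = trans (cong (_* y) norm≡) (lemma a b x y)
    where
    lemma : ∀ a b x y → (a * a + b * b) * y ≡ b * (a * x + b * y) + - a * (b * x - a * y)
    lemma = solve-∀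

  between : ∀ p q s → level p ≡ c → level q ≡ c → level s ≡ c →
            key p ℤ.≤ key q → key q ℤ.≤ key s → Between p q s
  between p q s p∈ℓ q∈ℓ s∈ℓ p≤q q≤s =
      betweenℤ (+ norm) (a * c) b (proj₁ p) (proj₁ q) (proj₁ s)
        (x-on p p∈ℓ) (x-on q q∈ℓ) (x-on s s∈ℓ) p≤q q≤s
    , betweenℤ (+ norm) (b * c) (- a) (proj₂ p) (proj₂ q) (proj₂ s)
        (y-on p p∈ℓ) (y-on q q∈ℓ) (y-on s s∈ℓ) p≤q q≤s
    where
    instance _ = positive norm>0
    x-on : ∀ p → level p ≡ c → + norm * proj₁ p ≡ a * c + b * key p
    x-on p refl = x-from-key p
    y-on : ∀ p → level p ≡ c → + norm * proj₂ p ≡ b * c + - a * key p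
    y-on p refl = y-from-key p

  key-injective : ∀ {p q} → level p ≡ level q → key p ≡ key q → p ≡ q
  key-injective {p} {q} level≡ key≡ = cong₂ _,_
    (ℤ.*-cancelˡ-≡ (+ norm) _ _ (trans (x-from-key p)
      (trans (cong₂ (λ l k → a * l + b * k) level≡ key≡) (sym (x-from-key q)))))
    (ℤ.*-cancelˡ-≡ (+ norm) _ _ (trans (y-from-key p)
      (trans (cong₂ (λ l k → b * l + - a * k) level≡ key≡) (sym (y-from-key q)))))
    where
    instance _ = >-nonZero norm>0

  level-shift : ∀ p q r → level (r ⊕ (q ⊖ p)) ≡ level r + (level q - level p)
  level-shift (x , y) (z , w) (u , v) = lemma a b x y z w u v
    where
    lemma : ∀ a b x y z w u v → a * (u + (z - x)) + b * (v + (w - y)) ≡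
            a * u + b * v + (a * z + b * w - (a * x + b * y))
    lemma = solve-∀

  key-shift : ∀ p q r → key (r ⊕ (q ⊖ p)) ≡ key r + (key q - key p)
  key-shift (x , y) (z , w) (u , v) = lemma a b x y z w u v
    where
    lemma : ∀ a b x y z w u v → b * (u + (z - x)) - a * (v + (w - y)) ≡
            b * u - a * v + (b * z - a * w - (b * x - a * y))
    lemma = solve-∀

  keyOrder : DecTotalOrder 0ℓ 0ℓ 0ℓ
  keyOrder = On.decTotalOrder ℤ.≤-decTotalOrder key

  module _ {e : Pred Point 0ℓ} (segment : ConsecutiveOn 5 ℓ e) where
    open ConsecutiveOn segment

    record Adjacent (p q : Point) : Set where
      constructor adjacent
      field
        p∈e : p ∈ᵖ e
        q∈e : q ∈ᵖ e
        p<q : key p ℤ.< key q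
        gap : ∀ {r} → r ∈ᵖ e → key p ℤ.< key r → ¬ key r ℤ.< key q

    -- If the step from p to q were shorter than the one from r to s, then
    -- translating it to r would give a point of the line skipped by e.
    step-≮ : ∀ {p q r s} → Adjacent p q → Adjacent r s →
             ¬ key (r ⊕ (q ⊖ p)) ℤ.< key s
    step-≮ {p} {q} {r} {s} (adjacent p∈e q∈e p<q _) (adjacent r∈e s∈e _ gap) m<s =
      gap (noGaps r m s r∈e s∈e m∈ℓ
        (between r m s (onLine r∈e) m∈ℓ (onLine s∈e) (ℤ.<⇒≤ r<m) (ℤ.<⇒≤ m<s))) r<m m<s
      where
      m = r ⊕ (q ⊖ p)
      m∈ℓ : level m ≡ c
      m∈ℓ = trans (level-shift p q r) (trans
        (cong₂ _+_ (onLine r∈e) (ℤ.i≡j⇒i-j≡0 (trans (onLine q∈e) (sym (onLine p∈e)))))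
        (ℤ.+-identityʳ c))
      r<m : key r ℤ.< key m
      r<m = subst₂ ℤ._<_ (ℤ.+-identityʳ _) (sym (key-shift p q r))
        (ℤ.+-monoʳ-< (key r) (subst (ℤ._< key q - key p) (ℤ.+-inverseʳ (key p))
          (ℤ.+-monoˡ-< (- key p) p<q)))

    -- By trichotomy of keys: a shorter step on either side is excluded by `step-≮`, used in both
    -- directions, and equal keys on the same line give equal points.
    equal-steps : ∀ {p q r s} → Adjacent p q → Adjacent r s → s ≡ r ⊕ (q ⊖ p)
    equal-steps {p} {q} {r} {s} pq rs with ℤ.<-cmp (key (r ⊕ (q ⊖ p))) (key s)
    ... | tri< m<s _ _ = ⊥-elim (step-≮ pq rs m<s)
    ... | tri≈ _ m≡s _ = key-injective
      (trans (onLine (Adjacent.q∈e rs)) (sym (trans (level-shift p q r) (trans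
        (cong₂ _+_ (onLine (Adjacent.p∈e rs))
          (ℤ.i≡j⇒i-j≡0 (trans (onLine (Adjacent.q∈e pq)) (sym (onLine (Adjacent.p∈e pq))))))
        (ℤ.+-identityʳ c))))) (sym m≡s)
    ... | tri> _ _ s<m = ⊥-elim (step-≮ rs pq (subst₂ ℤ._<_
        (trans (lemma (key p) (key r) (key s)) (sym (key-shift r s p)))
        (trans (cong (λ k → k - key r + key p) (key-shift p q r)) (lemma′ (key p) (key q) (key r)))
        (ℤ.+-monoˡ-< (key p) (ℤ.+-monoˡ-< (- key r) s<m))))
      where
      lemma : ∀ p r s → s - r + p ≡ p + (s - r)
      lemma = solve-∀
      lemma′ : ∀ p q r → r + (q - p) - r + p ≡ q
      lemma′ = solve-∀

    adjacent-sorted : ∀ us {u v vs} → Sorted key (us ++ u ∷ v ∷ vs) →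
                      e ≐ (_∈ us ++ u ∷ v ∷ vs) → Adjacent u v
    adjacent-sorted us sorted (e⊆ , ⊆e) = adjacent
      (⊆e (∈-++⁺ʳ us (here refl))) (⊆e (∈-++⁺ʳ us (there (here refl))))
      (sorted-step us sorted) λ r∈e → sorted-gap us sorted (e⊆ r∈e)

    -- Sorting by key is strict, since distinct points of a line have distinct keys. Neighbours in
    -- the sorted list are adjacent, so all four steps agree.
    isProgression : IsProgression e
    isProgression with size
    ... | xs , unique , length≡5 , e⊆ , ⊆e = build (sort xs) sorted
        (trans (↭-length (sort-↭ xs)) length≡5)
        ((λ p∈e → ∈-resp-↭ (↭-sym (sort-↭ xs)) (e⊆ p∈e)) , λ p∈ → ⊆e (∈-resp-↭ (sort-↭ xs) p∈))
      where
      open Sort keyOrder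
      e⊆ℓ : ∀ {p} → p ∈ sort xs → level p ≡ c
      e⊆ℓ p∈ = onLine (⊆e (∈-resp-↭ (sort-↭ xs) p∈))
      sorted : Sorted key (sort xs)
      sorted = strict (sort xs) e⊆ℓ (AllPairs.zip
        ( Sorted⇒AllPairs (DecTotalOrder.totalOrder keyOrder) (sort-↗ xs)
        , Permutation.Unique-resp-↭ (setoid Point) (↭⇒↭ₛ (↭-sym (sort-↭ xs))) unique))
        where
        strict : ∀ ys → (∀ {p} → p ∈ ys → level p ≡ c) →
                 AllPairs (λ p q → key p ℤ.≤ key q × p ≢ q) ys → Sorted key ys
        strict []       _    []       = []
        strict (y ∷ ys) ys⊆ℓ (p ∷ ps) = All.tabulate (λ z∈ys → let y≤z , y≢z = All.lookup p z∈ys in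
            ℤ.≤∧≢⇒< y≤z λ key≡ →
              y≢z (key-injective (trans (ys⊆ℓ (here refl)) (sym (ys⊆ℓ (there z∈ys)))) key≡))
          ∷ strict ys (ys⊆ℓ ∘ there) ps
      build : ∀ ys → Sorted key ys → length ys ≡ 5 → e ≐ (_∈ ys) → IsProgression e
      build (p ∷ q ∷ r ∷ s ∷ t ∷ []) sorted refl e≐ = p , d , d≢0 ,
        subst (λ ys → e ≐ (_∈ ys))
          (cong₂ _∷_ p≡ (cong₂ _∷_ q≡ (cong₂ _∷_ r≡ (cong₂ _∷_ s≡ (cong (_∷ []) t≡))))) e≐
        where
        d = q ⊖ p
        pq = adjacent-sorted [] sorted e≐
        next : ∀ {u v} k → u ≡ p ⊕ + k · d → v ≡ u ⊕ d → v ≡ p ⊕ + ℕ.suc k · d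
        next k refl refl = ⊕-step p d (+ k)
        p≡ = sym (⊕-zero p d 0ℤ)
        q≡ = next 0 p≡ (sym (⊕-⊖ p q))
        r≡ = next 1 q≡ (equal-steps pq (adjacent-sorted (p ∷ []) sorted e≐))
        s≡ = next 2 r≡ (equal-steps pq (adjacent-sorted (p ∷ q ∷ []) sorted e≐))
        t≡ = next 3 s≡ (equal-steps pq (adjacent-sorted (p ∷ q ∷ r ∷ []) sorted e≐))
        d≢0 : d ≢ (0ℤ , 0ℤ)
        d≢0 d≡0 = ℤ.<-irrefl (cong key (trans (⊕-identityʳ p)
          (trans (cong (p ⊕_) (sym d≡0)) (⊕-⊖ p q)))) (Adjacent.p<q pq)

-- Progressions through given points

det : Point → Point → ℤ
det (x , y) (z , w) = x * w - y * z

-- (i , c) stands for two points at the positions i and i + 12 / c of a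
-- progression.
placements : List (ℕ × ℕ)
placements =
  (0 , 12) ∷ (0 , 6) ∷ (0 , 4) ∷ (0 , 3) ∷ (1 , 12) ∷ (1 , 6) ∷ (1 , 4) ∷
  (2 , 12) ∷ (2 , 6) ∷ (3 , 12) ∷ []

placement : ∀ {i j} → i ℕ.< j → j ℕ.< 5 →
            ∃[ c ] (i , c) ∈ placements × + c * (+ j - + i) ≡ + 12
placement i<j j<5 with find (All.lookup (All.lookup table (∈-upTo⁺ j<5)) (∈-upTo⁺ i<j))
  where
  -- Checked by evaluation over all pairs of indices `i < j < 5`: the distance is 1, 2, 3 or 4, and
  -- each of these divides 12.
  table = from-yes (All.all? (λ j → All.all? (λ i →
    any? (λ (i′ , c) → i ℕ.≟ i′ ×-dec + c * (+ j - + i) ℤ.≟ + 12) placements) (upTo j)) (upTo 5))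
... | (_ , c) , ic∈ , refl , eq = c , ic∈ , eq

∈-progression⁺ : ∀ p d i {m} → m ℕ.< 5 → p ⊕ (+ m - + i) · d ∈ progression p d i
∈-progression⁺ p d i m<5 = ∈-map⁺ (λ m → p ⊕ (+ m - + i) · d) (∈-upTo⁺ m<5)

∈-progression⁻ : ∀ p d i {q} → q ∈ progression p d i → ∃[ m ] m ℕ.< 5 × q ≡ p ⊕ (+ m - + i) · d
∈-progression⁻ p d i q∈ with ∈-map⁻ (λ m → p ⊕ (+ m - + i) · d) q∈
... | m , m∈ , eq = m , ∈-upTo⁻ m∈ , eq

recentre : ∀ p d i m → progression p d i ≡ progression (p ⊕ (+ m - + i) · d) d m
recentre (x , y) (z , w) i m = map-cong
  (λ j → cong₂ _,_ (lemma (+ i) (+ m) (+ j) x z) (lemma (+ i) (+ m) (+ j) y w)) (upTo 5)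
  where
  lemma : ∀ i m j x z → x + (j - i) * z ≡ x + (m - i) * z + (j - m) * z
  lemma = solve-∀

-1·-1· : ∀ d → -1ℤ · (-1ℤ · d) ≡ d
-1·-1· (x , y) = cong₂ _,_ (lemma x) (lemma y)
  where
  lemma : ∀ z → -1ℤ * (-1ℤ * z) ≡ z
  lemma = solve-∀

-- Complementing indices negates their differences, which cancels the negated step; the bounds by 4
-- make the truncated subtraction exact.
reverse-point : ∀ p d {i m} → i ℕ.≤ 4 → m ℕ.≤ 4 →
                p ⊕ (+ m - + i) · d ≡ p ⊕ (+ (4 ℕ.∸ m) - + (4 ℕ.∸ i)) · (-1ℤ · d)
reverse-point (x , y) (z , w) {i} {m} i≤4 m≤4 = cong₂ _,_ (same x z) (same y w)
  where
  i′ = 4 ℕ.∸ i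
  m′ = 4 ℕ.∸ m
  lemma : ∀ i i′ m m′ x z → x + (m′ - i′) * (-1ℤ * z) ≡ x + ((i + i′) - (m + m′) + (m - i)) * z
  lemma = solve-∀
  sums : + i + + i′ ≡ + m + + m′
  sums = cong +_ (trans (ℕ.m+[n∸m]≡n i≤4) (sym (ℕ.m+[n∸m]≡n m≤4)))
  same : ∀ x z → x + (+ m - + i) * z ≡ x + (+ m′ - + i′) * (-1ℤ * z)
  same x z = sym (trans (lemma (+ i) (+ i′) (+ m) (+ m′) x z) (cong (λ s → x + s * z)
    (trans (cong (_+ (+ m - + i)) (ℤ.i≡j⇒i-j≡0 sums)) (ℤ.+-identityˡ (+ m - + i)))))

reverse-⊆ : ∀ p d {i} → i ℕ.≤ 4 → (_∈ progression p d i) ⊆ (_∈ progression p (-1ℤ · d) (4 ℕ.∸ i))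
reverse-⊆ p d {i} i≤4 q∈ with ∈-progression⁻ p d i q∈
... | m , m<5 , refl = subst (_∈ progression p (-1ℤ · d) (4 ℕ.∸ i))
    (sym (reverse-point p d i≤4 (s≤s⁻¹ m<5))) (∈-progression⁺ p (-1ℤ · d) (4 ℕ.∸ i) (s≤s (ℕ.m∸n≤m 4 m)))

reverse-≐ : ∀ p d {i} → i ℕ.≤ 4 → (_∈ progression p d i) ≐ (_∈ progression p (-1ℤ · d) (4 ℕ.∸ i))
reverse-≐ p d {i} i≤4 = reverse-⊆ p d i≤4 ,
  λ {q} q∈ → subst₂ (λ d i → q ∈ progression p d i) (-1·-1· d) (ℕ.m∸[m∸n]≡n i≤4)
    (reverse-⊆ p (-1ℤ · d) (ℕ.m∸n≤m 4 i) q∈)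

-1·≢0 : ∀ {d} → d ≢ (0ℤ , 0ℤ) → -1ℤ · d ≢ (0ℤ , 0ℤ)
-1·≢0 {d} d≢0 eq = d≢0 (trans (sym (-1·-1· d)) (cong (-1ℤ ·_) eq))

-- Reversing the progression halves the number of positions to consider.
pointed : ∀ {e p} → IsProgression e → p ∈ᵖ e →
          ∃[ d ] ∃[ i ] d ≢ (0ℤ , 0ℤ) × i ℕ.≤ 2 × e ≐ (_∈ progression p d i)
pointed {e} (p₀ , d , d≢0 , e≐@(e⊆ , _)) p∈e with ∈-progression⁻ p₀ d 0 (e⊆ p∈e)
... | m , m<5 , refl with recentred ← subst (λ ps → e ≐ (_∈ ps)) (recentre p₀ d 0 m) e≐ | m ℕ.≤? 2
...   | yes m≤2 = d , m , d≢0 , m≤2 , recentred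
...   | no  m≰2 = -1ℤ · d , 4 ℕ.∸ m , -1·≢0 d≢0 , ℕ.∸-monoʳ-≤ 4 (ℕ.<⇒≤ (ℕ.≰⇒> m≰2)) ,
        ≐-trans recentred (reverse-≐ (p₀ ⊕ (+ m - + 0) · d) d (s≤s⁻¹ m<5))

-- The progression is oriented so that `p` comes before `q`, with `k = 12 / c` steps between them.
record Through (p q : Point) (e : Pred Point 0ℓ) : Set where
  constructor placedThrough
  field
    {i c}     : ℕ
    k         : ℤ
    d         : Point
    placed    : (i , c) ∈ placements
    c*k≡12    : + c * k ≡ + 12
    q≡        : q ≡ p ⊕ k · d
    e≐        : e ≐ (_∈ progression p d i)

-- If `q` comes before `p`, the reversed progression has the required orientation.
through-two : ∀ {e p q} → IsProgression e → p ∈ᵖ e → q ∈ᵖ e → p ≢ q → Through p q e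
through-two {p = p} prog p∈e q∈e p≢q with pointed prog p∈e
... | d , i , _ , i≤2 , e≐@(e⊆ , _) with ∈-progression⁻ p d i (e⊆ q∈e)
...   | j , j<5 , q≡ with ℕ.<-cmp i j
...     | tri< i<j _ _ = let c , placed , ck≡12 = placement i<j j<5
                         in placedThrough {i = i} _ d placed ck≡12 q≡ e≐
...     | tri≈ _ refl _ = contradiction (sym (trans q≡ (⊕-zero p d (+ i)))) p≢q
...     | tri> _ _ j<i = let
    i≤4 = ℕ.≤-trans i≤2 (s≤s (s≤s ℕ.z≤n))
    c , placed , ck≡12 = placement (ℕ.∸-monoʳ-< {4} j<i i≤4) (s≤s (ℕ.m∸n≤m 4 j))
  in placedThrough {i = 4 ℕ.∸ i} _ (-1ℤ · d) placed ck≡12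
       (trans q≡ (reverse-point p d i≤4 (s≤s⁻¹ j<5))) (≐-trans e≐ (reverse-≐ p d i≤4))

-- Affine coordinates with a common denominator

module Frame (o u v : Point) (det≢0 : det u v ≢ 0ℤ) where

  combine : Point → Point
  combine (x , y) = x · u ⊕ y · v

  -- p has the coordinates x / n with respect to the origin o and the basis u, v.
  record Represents (n : ℤ) (x p : Point) : Set where
    constructor represents
    field
      equation : n · (p ⊖ o) ≡ combine x

  -- Cramer's rule, with the nonzero determinant cancelled.
  combine-injective : ∀ {x y} → combine x ≡ combine y → x ≡ y
  combine-injective {x₁ , x₂} {y₁ , y₂} eq = cong₂ _,_
    (ℤ.*-cancelˡ-≡ (det u v) x₁ y₁ (trans (cramer₁ (proj₁ u) (proj₂ u) (proj₁ v) (proj₂ v) x₁ x₂)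
      (trans (cong₂ (λ s t → s * proj₂ v - t * proj₁ v) (cong proj₁ eq) (cong proj₂ eq))
        (sym (cramer₁ (proj₁ u) (proj₂ u) (proj₁ v) (proj₂ v) y₁ y₂)))))
    (ℤ.*-cancelˡ-≡ (det u v) x₂ y₂ (trans (cramer₂ (proj₁ u) (proj₂ u) (proj₁ v) (proj₂ v) x₁ x₂)
      (trans (cong₂ (λ s t → t * proj₁ u - s * proj₂ u) (cong proj₁ eq) (cong proj₂ eq))
        (sym (cramer₂ (proj₁ u) (proj₂ u) (proj₁ v) (proj₂ v) y₁ y₂)))))
    where
    instance _ = ≢-nonZero det≢0
    cramer₁ : ∀ u₁ u₂ v₁ v₂ x y →
              (u₁ * v₂ - u₂ * v₁) * x ≡ (x * u₁ + y * v₁) * v₂ - (x * u₂ + y * v₂) * v₁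
    cramer₁ = solve-∀
    cramer₂ : ∀ u₁ u₂ v₁ v₂ x y →
              (u₁ * v₂ - u₂ * v₁) * y ≡ (x * u₂ + y * v₂) * u₁ - (x * u₁ + y * v₁) * u₂
    cramer₂ = solve-∀

  represents-unique : ∀ {n x y p} → Represents n x p → Represents n y p → x ≡ y
  represents-unique (represents x) (represents y) = combine-injective (trans (sym x) y)

  represents-injective : ∀ {n x p q} .{{_ : NonZero n}} → Represents n x p → Represents n x q → p ≡ q
  represents-injective {n} {x} {p₁ , p₂} {q₁ , q₂} (represents p) (represents q) = cong₂ _,_
    (cancel (proj₁ o) p₁ q₁ (cong proj₁ (trans p (sym q))))
    (cancel (proj₂ o) p₂ q₂ (cong proj₂ (trans p (sym q))))
    where
    cancel : ∀ o p q → n * (p - o) ≡ n * (q - o) → p ≡ q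
    cancel o p q eq = ℤ.i-j≡0⇒i≡j p q (trans (lemma o p q)
      (ℤ.i≡j⇒i-j≡0 (ℤ.*-cancelˡ-≡ n (p - o) (q - o) eq)))
      where
      lemma : ∀ o p q → p - q ≡ p - o - (q - o)
      lemma = solve-∀

  represents-scale : ∀ m {n x p} → Represents n x p → Represents (m * n) (m · x) p
  represents-scale m {n} {x₁ , x₂} {p₁ , p₂} (represents eq) = represents (cong₂ _,_
    (trans (ℤ.*-assoc m n (p₁ - proj₁ o))
      (trans (cong (m *_) (cong proj₁ eq)) (lemma m x₁ x₂ (proj₁ u) (proj₁ v))))
    (trans (ℤ.*-assoc m n (p₂ - proj₂ o))
      (trans (cong (m *_) (cong proj₂ eq)) (lemma m x₁ x₂ (proj₂ u) (proj₂ v)))))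
    where
    lemma : ∀ m x y u v → m * (x * u + y * v) ≡ m * x * u + m * y * v
    lemma = solve-∀

  -- The step `d` is the difference of the two known points divided by `k`. Scaling by `c * k`
  -- clears this division, so the numerators stay integral.
  represents-along : ∀ {n x y p} d c k t → Represents n x p → Represents n y (p ⊕ k · d) →
                     Represents (c * k * n) ((c * k) · x ⊕ t · (c · (y ⊖ x))) (p ⊕ t · d)
  represents-along {n} {x₁ , x₂} {y₁ , y₂} {p₁ , p₂} (d₁ , d₂) c k t (represents x) (represents y) =
    represents (cong₂ _,_
    (along (proj₁ o) p₁ d₁ (proj₁ u) (proj₁ v) (cong proj₁ x) (cong proj₁ y))
    (along (proj₂ o) p₂ d₂ (proj₂ u) (proj₂ v) (cong proj₂ x) (cong proj₂ y)))
    where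
    split : ∀ n c k t o p d → c * k * n * (p + t * d - o) ≡
            c * k * (n * (p - o)) + t * (c * (n * (p + k * d - o) - n * (p - o)))
    split = solve-∀
    collect : ∀ m c t x₁ x₂ y₁ y₂ u v →
      m * (x₁ * u + x₂ * v) + t * (c * (y₁ * u + y₂ * v - (x₁ * u + x₂ * v))) ≡
      (m * x₁ + t * (c * (y₁ - x₁))) * u + (m * x₂ + t * (c * (y₂ - x₂))) * v
    collect = solve-∀
    along : ∀ o p d u v → n * (p - o) ≡ x₁ * u + x₂ * v → n * (p + k * d - o) ≡ y₁ * u + y₂ * v →
      c * k * n * (p + t * d - o) ≡
      (c * k * x₁ + t * (c * (y₁ - x₁))) * u + (c * k * x₂ + t * (c * (y₂ - x₂))) * v
    along o p d u v eq₁ eq₂ = trans (split n c k t o p d)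
      (trans (cong₂ (λ s s′ → c * k * s + t * (c * (s′ - s))) eq₁ eq₂)
        (collect (c * k) c t x₁ x₂ y₁ y₂ u v))

  represents-axis : ∀ k x → Represents 1ℤ ((0ℤ , 0ℤ) ⊕ k · x) (o ⊕ k · combine x)
  represents-axis k (x , y) = represents (cong₂ _,_
    (lemma (proj₁ o) k x y (proj₁ u) (proj₁ v)) (lemma (proj₂ o) k x y (proj₂ u) (proj₂ v)))
    where
    lemma : ∀ o k x y u v → 1ℤ * (o + k * (x * u + y * v) - o) ≡ (0ℤ + k * x) * u + (0ℤ + k * y) * v
    lemma = solve-∀

  combine-e₁ : combine (1ℤ , 0ℤ) ≡ u
  combine-e₁ = cong₂ _,_ (lemma (proj₁ u) (proj₁ v)) (lemma (proj₂ u) (proj₂ v))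
    where
    lemma : ∀ u v → 1ℤ * u + 0ℤ * v ≡ u
    lemma = solve-∀

  combine-e₂ : combine (0ℤ , 1ℤ) ≡ v
  combine-e₂ = cong₂ _,_ (lemma (proj₁ u) (proj₁ v)) (lemma (proj₂ u) (proj₂ v))
    where
    lemma : ∀ u v → 0ℤ * u + 1ℤ * v ≡ v
    lemma = solve-∀

-- The vector `m · (r ⊖ x)` is a multiple of `e`, and `m` cancels. This justifies the test
-- `aligned`.
det-aligned : ∀ m t c .{{_ : NonZero m}} x r e →
              m · r ≡ m · x ⊕ t · (c · e) → det (r ⊖ x) e ≡ 0ℤ
det-aligned m t c (x₁ , x₂) (r₁ , r₂) (e₁ , e₂) eq = ℤ.*-cancelˡ-≡ m _ 0ℤ (trans (expand m x₁ x₂ r₁ r₂ e₁ e₂)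
  (trans (cong₂ (λ s s′ → (s - m * x₁) * e₂ - (s′ - m * x₂) * e₁) (cong proj₁ eq) (cong proj₂ eq))
    (trans (vanish m t c x₁ x₂ e₁ e₂) (sym (ℤ.*-zeroʳ m)))))
  where
  expand : ∀ m x₁ x₂ r₁ r₂ e₁ e₂ → m * ((r₁ - x₁) * e₂ - (r₂ - x₂) * e₁) ≡
           (m * r₁ - m * x₁) * e₂ - (m * r₂ - m * x₂) * e₁
  expand = solve-∀
  vanish : ∀ m t c x₁ x₂ e₁ e₂ →
           (m * x₁ + t * (c * e₁) - m * x₁) * e₂ - (m * x₂ + t * (c * e₂) - m * x₂) * e₁ ≡ 0ℤ
  vanish = solve-∀

-- The search

-- Unlike Defs._≟_ this decides without inspecting proofs, so that it
-- evaluates quickly.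
_≟ᵖ_ : DecidableEquality Point
(x , y) ≟ᵖ (z , w) = Dec.map′ (uncurry (cong₂ _,_)) Product.,-injective (x ℤ.≟ z ×-dec y ℤ.≟ w)

open import Data.List.Membership.DecPropositional _≟ᵖ_ using (_∈?_; _∉?_)

-- 12 is divisible by all distances of two points of an edge, so scaling by
-- it keeps the coordinates of the new edge integral.
through : Point → Point → List Edge
through p q = map (λ (i , c) → progression (+ 12 · p) (+ c · (q ⊖ p)) i) placements

-- For the common points of two different edges: the empty list fails because edges intersect, and
-- two different entries fail because edges share at most one point.
single : List Point → Bool
single [] = false
single (p ∷ ps) = all (λ q → does (p ≟ᵖ q)) ps

admissible : List Edge → List Point → Edge → Bool
admissible es C f = all (λ p → does (p ∉? f)) C ∧ all (λ g → single (filter (_∈? f) g)) es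

-- A necessary condition for an edge through p and p ⊕ d to meet all of es,
-- which prunes most pairs of points before any progression is tried.
aligned : List Edge → Point → Point → Bool
aligned es p d = all (any λ r → does (det (r ⊖ p) d ℤ.≟ 0ℤ)) es

-- The covers to try, given the edges known so far.
Strategy : Set
Strategy = List Edge → List (List Point)

enlarge : Edge → Edge
enlarge = map (+ 12 ·_)

targets : List Edge → List Point → Point → Edge → List Point
targets es C p g = filterᵇ (λ q → aligned es p (q ⊖ p)) (filter (_∉? C) g)

extensions : List Edge → List Point → Point → Point → List Edge
extensions es C p q = filterᵇ (admissible es C) (through p q)

-- In the following functions es′ and C′ are es and C scaled by 12; they are
-- arguments in order to be computed only once.
closes : (List Edge → Bool) → (es es′ : List Edge) (C C′ : List Point) → Point → Edge → Bool
closes R es es′ C C′ p g =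
  all (λ q → all (λ f → R (f ∷ es′)) (extensions es′ C′ p q)) (targets es C p g)

-- An edge missing C meets e in some p; if g avoids p, it meets g in another
-- point.
blocks : (List Edge → Bool) → Edge → (es es′ : List Edge) (C C′ : List Point) → Bool
blocks R e es es′ C C′ =
  all (λ p → any (closes R es es′ C C′ p) (take 1 (filter (p ∉?_) es))) (filter (_∉? C) e)

-- `C` must be small and consist of known points to be an instance of `uncovered`. It must hit every
-- known edge so that an edge missing it is new.
wins : (List Edge → Bool) → Edge → List Edge → List Point → Bool
wins R e es C =
  does (length C ℕ.≤? 3) ∧
  all (λ g → any (λ p → does (p ∈? g)) C) es ∧
  all (λ p → any (λ g → does (p ∈? g)) es) C ∧
  blocks R e es (map enlarge es) C (map (+ 12 ·_) C)

-- The list of strategies bounds the depth: each added edge consumes one, and a branch that outlives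
-- the list counts as a failure.
refutes : List Strategy → List Edge → Bool
refutes []       _          = false
refutes (s ∷ ss) []         = false
refutes (s ∷ ss) es@(e ∷ _) = any (wins (refutes ss) e es) (s es)

common : Edge → Edge → List Point
common e f = filter (_∈? e) f

crossings : List Edge → List Point
crossings [] = []
crossings (e ∷ es) = concatMap (common e) es ++ crossings es

pick : ∀ {A : Set} → List A → List (A × List A)
pick [] = []
pick (x ∷ xs) = (x , xs) ∷ map (λ (y , ys) → y , x ∷ ys) (pick xs)

sublists : ℕ → List Point → List (List Point)
sublists zero _ = [] ∷ []
sublists (suc n) [] = []
sublists (suc n) (x ∷ xs) = map (x ∷_) (sublists n xs) ++ sublists (suc n) xs

-- firstThree is used for the two axes, whose common point is the first point
-- of the head.  The three vertices on a side of a complete quadrilateral meet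
-- all its sides and diagonals, so few further edges miss one of the stars.
firstThree triangle stars triples : Strategy
firstThree es = map (take 3) (take 1 es)
triangle es = crossings es ∷ []
stars es = map (λ (e , fs) → concatMap (common e) fs) (pick es)
triples es = sublists 3 (deduplicate _≟ᵖ_ (crossings es))

axis₁ : Edge
axis₁ = progression (0ℤ , 0ℤ) (1ℤ , 0ℤ) 0

-- The argument is the index of the origin on the second axis; the first axis starts at the origin.
axis₂ : ℕ → Edge
axis₂ = progression (0ℤ , 0ℤ) (0ℤ , 1ℤ)

-- Starting from the two axes, these are applied to families of two, three, four and five edges in
-- turn.
strategies : List Strategy
strategies = firstThree ∷ triangle ∷ stars ∷ triples ∷ []

-- Soundness of the search

T-does : ∀ {A : Set} (a? : Dec A) → A → T (does a?)
T-does a? a = Equivalence.from T-≡ (Dec.dec-true a? a)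

T-does⁻ : ∀ {A : Set} (a? : Dec A) → T (does a?) → A
T-does⁻ (yes a) _ = a

∈-take⁻ : ∀ {A : Set} n {x : A} {xs} → x ∈ take n xs → x ∈ xs
∈-take⁻ (suc n) {xs = _ ∷ _} (here eq)  = here eq
∈-take⁻ (suc n) {xs = _ ∷ _} (there x∈) = there (∈-take⁻ n x∈)

single-complete : ∀ ps {p} → p ∈ ps → (∀ {p q} → p ∈ ps → q ∈ ps → p ≡ q) → T (single ps)
single-complete (p ∷ ps) _ equal = All.all⁻ (λ q → does (p ≟ᵖ q))
  (All.tabulate λ {q} q∈ → T-does (p ≟ᵖ q) (equal (here refl) (there q∈)))

-- `uncovered` is a negation because membership in `E` need not be decidable: an edge missing `C`
-- cannot be exhibited, but refuting every such edge gives a contradiction.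
module Soundness
  {E : Pred (Pred Point 0ℓ) 0ℓ}
  (progressive  : ∀ {e} → e ∈ᵖ E → IsProgression e)
  (intersecting : ∀ {e f} → e ∈ᵖ E → f ∈ᵖ E → e ≬ f)
  (linear       : ∀ {e f p q} → e ∈ᵖ E → f ∈ᵖ E → p ∈ᵖ e → p ∈ᵖ f →
                  q ∈ᵖ e → q ∈ᵖ f → p ≢ q → e ≐ f)
  (uncovered    : ∀ C → length C ℕ.≤ 3 → All (λ p → ∃[ e ] e ∈ᵖ E × p ∈ᵖ e) C →
                  ¬ (∀ f → f ∈ᵖ E → ¬ (∀ {p} → p ∈ C → ¬ p ∈ᵖ f)))
  (o u v : Point) (det≢0 : det u v ≢ 0ℤ) where

  open Frame o u v det≢0

  -- Some edge of the family has exactly the points with coordinates xs / n.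
  record Realised (n : ℤ) (xs : Edge) : Set₁ where
    field
      {e}  : Pred Point 0ℓ
      e∈E  : e ∈ᵖ E
      to   : ∀ {p} → p ∈ᵖ e → ∃[ x ] x ∈ xs × Represents n x p
      from : ∀ {x} → x ∈ xs → ∃[ p ] p ∈ᵖ e × Represents n x p
  open Realised

  realised-∈ : ∀ {n xs x p} (X : Realised n xs) → p ∈ᵖ e X → Represents n x p → x ∈ xs
  realised-∈ {n} {xs} {x} {p} X p∈e x↦p with to X p∈e
  ... | y , y∈xs , y↦p = subst (_∈ xs) (represents-unique y↦p x↦p) y∈xs

  realised-∋ : ∀ {n xs x p} .{{_ : NonZero n}} (X : Realised n xs) → x ∈ xs → Represents n x p → p ∈ᵖ e X
  realised-∋ {n} {xs} {x} {p} X x∈xs x↦p with from X x∈xs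
  ... | q , q∈e , x↦q = subst (e X) (represents-injective x↦q x↦p) q∈e

  realised-enlarge : ∀ {n xs} → Realised n xs → Realised (+ 12 * n) (enlarge xs)
  realised-enlarge {n} {xs} X = record
    { e∈E  = e∈E X
    ; to   = λ {p} p∈e → let x , x∈xs , x↦p = to X p∈e in
               + 12 · x , ∈-map⁺ (+ 12 ·_) x∈xs , represents-scale (+ 12) x↦p
    ; from = from′
    }
    where
    from′ : ∀ {y} → y ∈ enlarge xs → ∃[ p ] p ∈ᵖ e X × Represents (+ 12 * n) y p
    from′ y∈ with ∈-map⁻ (+ 12 ·_) y∈
    ... | x , x∈xs , refl = let p , p∈e , x↦p = from X x∈xs in p , p∈e , represents-scale (+ 12) x↦p

  -- `intersecting` provides a common point, and a second one would make the edges equal by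
  -- `linear`.
  realised-single : ∀ {n xs ys} .{{_ : NonZero n}} (X : Realised n xs) (Y : Realised n ys) →
                    ¬ e X ≐ e Y → T (single (filter (_∈? ys) xs))
  realised-single {n} {xs} {ys} X Y X≢Y with intersecting (e∈E X) (e∈E Y)
  ... | p , p∈X , p∈Y with to X p∈X
  ...   | x , x∈xs , x↦p = single-complete _ (∈-filter⁺ (_∈? ys) x∈xs (realised-∈ Y p∈Y x↦p)) equal
    where
    equal : ∀ {x y} → x ∈ filter (_∈? ys) xs → y ∈ filter (_∈? ys) xs → x ≡ y
    equal {x} {y} x∈ y∈ with ∈-filter⁻ (_∈? ys) {xs = xs} x∈ | ∈-filter⁻ (_∈? ys) {xs = xs} y∈
    ... | x∈xs , x∈ys | y∈xs , y∈ys with from X x∈xs | from X y∈xs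
    ...   | p , p∈X , x↦p | q , q∈X , y↦q with p ≟ᵖ q
    ...     | yes refl = represents-unique x↦p y↦q
    ...     | no p≢q = contradiction (linear (e∈E X) (e∈E Y)
                p∈X (realised-∋ Y x∈ys x↦p) q∈X (realised-∋ Y y∈ys y↦q) p≢q) X≢Y

  KnownPoint : ℤ → Point → Set₁
  KnownPoint n x = ∃[ p ] (∃[ e ] e ∈ᵖ E × p ∈ᵖ e) × Represents n x p

  choose : ∀ {n C} → All (KnownPoint n) C → ∃[ ps ] length ps ≡ length C ×
           All (λ p → ∃[ e ] e ∈ᵖ E × p ∈ᵖ e) ps × (∀ {x} → x ∈ C → ∃[ p ] p ∈ ps × Represents n x p)
  choose []                     = [] , refl , [] , λ ()
  choose ((p , known , x↦p) ∷ C) with choose C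
  ... | ps , length≡ , all-known , lookup = p ∷ ps , cong suc length≡ , known ∷ all-known ,
    λ { (here refl) → p , here refl , x↦p
      ; (there x∈)  → let q , q∈ , x↦q = lookup x∈ in q , there q∈ , x↦q }

  realised-progression : ∀ {n f} x y p d i → f ∈ᵖ E → f ≐ (_∈ progression p d i) →
                         (∀ k → Represents n (x ⊕ k · y) (p ⊕ k · d)) → Realised n (progression x y i)
  realised-progression {n} {f} x y p d i f∈E (f⊆ , ⊆f) point = record
    { e∈E  = f∈E
    ; to   = to′ ∘ f⊆
    ; from = from′
    }
    where
    to′ : ∀ {q} → q ∈ progression p d i → ∃[ z ] z ∈ progression x y i × Represents n z q
    to′ q∈ with ∈-progression⁻ p d i q∈
    ... | m , m<5 , refl = _ , ∈-progression⁺ x y i m<5 , point (+ m - + i)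
    from′ : ∀ {z} → z ∈ progression x y i → ∃[ q ] q ∈ᵖ f × Represents n z q
    from′ z∈ with ∈-progression⁻ x y i z∈
    ... | m , m<5 , refl = _ , ⊆f (∈-progression⁺ p d i m<5) , point (+ m - + i)

  realised-axis : ∀ {f} x i → f ∈ᵖ E → f ≐ (_∈ progression o (combine x) i) →
                  Realised 1ℤ (progression (0ℤ , 0ℤ) x i)
  realised-axis x i f∈E f≐ =
    realised-progression (0ℤ , 0ℤ) x o (combine x) i f∈E f≐ (λ k → represents-axis k x)

  -- The denominator is arbitrary because every added edge multiplies it by 12.
  Sound : (List Edge → Bool) → Set₁
  Sound R = ∀ {n es} .{{_ : NonZero n}} → All (Realised n) es → ¬ T (R es)

  module _
    {R} (R-sound : Sound R)
    {n} .{{_ : NonZero n}} {xs es} (X : Realised n xs) (known : All (Realised n) es)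
    {C : List Point} (covering : All (λ g → Any (_∈ g) C) es)
    (C-known : ∀ {x} → x ∈ C → ∃[ p ] Represents n x p)
    (blocked : T (blocks R xs es (map enlarge es) C (map (+ 12 ·_) C)))
    (f : Pred Point 0ℓ) (f∈E : f ∈ᵖ E)
    (miss : ∀ {x p} → x ∈ C → Represents n x p → ¬ p ∈ᵖ f) where

    instance
      12n≢0 : NonZero (+ 12 * n)
      12n≢0 = ℤ.i*j≢0 (+ 12) n

    new-point : ∀ {x p} → p ∈ᵖ f → Represents n x p → x ∉ C
    new-point p∈f x↦p x∈C = miss x∈C x↦p p∈f

    new-edge : ∀ {g} (G : Realised n g) → Any (_∈ g) C → ¬ e G ≐ f
    new-edge G hit (G⊆f , _) with find hit
    ... | x , x∈C , x∈g with from G x∈g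
    ...   | p , p∈G , x↦p = miss x∈C x↦p (G⊆f p∈G)

    es′ = map enlarge es
    C′  = map (+ 12 ·_) C

    -- In scaled coordinates `f` is one of the progressions tried for `x` and `y`: it passes the
    -- tests `aligned` and `admissible`. Hence `R` has refuted the family enlarged by `f`, which is
    -- realised.
    unblocked : ∀ {x y g p q} → Represents n x p → p ∈ᵖ f → y ∈ g → Represents n y q → q ∈ᵖ f →
                Through p q f → ¬ T (closes R es es′ C C′ x g)
    unblocked {x} {y} {g} {p} x↦p p∈f y∈g y↦q q∈f
              (placedThrough {i} {c} k d placed ck≡12 refl f≐) ok =
      R-sound {+ 12 * n} {progression (+ 12 · x) (+ c · (y ⊖ x)) i ∷ es′}
        (F ∷ All.map⁺ (All.map realised-enlarge known))
        (All.lookup (All.all⁺ (λ f → R (f ∷ es′)) (extensions es′ C′ x y)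
          (All.lookup (All.all⁺ (λ q → all (λ f → R (f ∷ es′)) (extensions es′ C′ x q))
            (targets es C x g) ok) y∈targets)) F∈extensions)
      where
      along : ∀ t → Represents (+ 12 * n) (+ 12 · x ⊕ t · (+ c · (y ⊖ x))) (p ⊕ t · d)
      along t = subst (λ z → Represents (z * n) (z · x ⊕ t · (+ c · (y ⊖ x))) (p ⊕ t · d)) ck≡12
        (represents-along d (+ c) k t x↦p y↦q)

      F : Realised (+ 12 * n) (progression (+ 12 · x) (+ c · (y ⊖ x)) i)
      F = realised-progression (+ 12 · x) (+ c · (y ⊖ x)) p d i f∈E f≐ along

      aligned-y : T (aligned es x (y ⊖ x))
      aligned-y = All.all⁻ (any λ r → does (det (r ⊖ x) (y ⊖ x) ℤ.≟ 0ℤ)) (All.map meets known)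
        where
        meets : ∀ {g} → Realised n g → T (any (λ r → does (det (r ⊖ x) (y ⊖ x) ℤ.≟ 0ℤ)) g)
        meets {g} G with intersecting (e∈E G) f∈E
        ... | s , s∈G , s∈f with to G s∈G | ∈-progression⁻ p d i (proj₁ f≐ s∈f)
        ...   | r , r∈g , r↦s | m , m<5 , refl =
          any⁺ (λ r → does (det (r ⊖ x) (y ⊖ x) ℤ.≟ 0ℤ)) (lose r∈g
            (T-does (det (r ⊖ x) (y ⊖ x) ℤ.≟ 0ℤ) (det-aligned (+ 12) (+ m - + i) (+ c) x r (y ⊖ x)
              (represents-unique (represents-scale (+ 12) r↦s) (along (+ m - + i))))))

      y∈targets : y ∈ targets es C x g
      y∈targets = ∈-filter⁺ (T? ∘ λ q → aligned es x (q ⊖ x))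
        (∈-filter⁺ (_∉? C) y∈g (new-point q∈f y↦q)) aligned-y

      admissible-F : T (admissible es′ C′ (progression (+ 12 · x) (+ c · (y ⊖ x)) i))
      admissible-F = Equivalence.from T-∧
        ( All.all⁻ (λ p → does (p ∉? F′))
            (All.map⁺ (All.tabulate λ {z} z∈C → T-does (+ 12 · z ∉? F′) (avoids z∈C)))
        , All.all⁻ (λ g → single (filter (_∈? F′) g)) (All.map⁺ (All.zipWith
            (λ (G , hit) → realised-single (realised-enlarge G) F (new-edge G hit))
            (known , covering))))
        where
        F′ = progression (+ 12 · x) (+ c · (y ⊖ x)) i
        avoids : ∀ {z} → z ∈ C → + 12 · z ∉ progression (+ 12 · x) (+ c · (y ⊖ x)) i
        avoids {z} z∈C 12z∈ with C-known z∈C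
        ... | r , z↦r = miss z∈C z↦r (realised-∋ F 12z∈ (represents-scale (+ 12) z↦r))

      F∈extensions : progression (+ 12 · x) (+ c · (y ⊖ x)) i ∈ extensions es′ C′ x y
      F∈extensions = ∈-filter⁺ (T? ∘ admissible es′ C′)
        (∈-map⁺ (λ (i , c) → progression (+ 12 · x) (+ c · (y ⊖ x)) i) placed) admissible-F

    step : ⊥
    step =
      let p , p∈X , p∈f  = intersecting (e∈E X) f∈E
          x , x∈xs , x↦p = to X p∈X
          g , g∈ , ok    = find (any⁻ (closes R es es′ C C′ x) (take 1 (filter (x ∉?_) es))
            (All.lookup (All.all⁺ (λ x → any (closes R es es′ C C′ x) (take 1 (filter (x ∉?_) es)))
              (filter (_∉? C) xs) blocked)
              (∈-filter⁺ (_∉? C) x∈xs (new-point p∈f x↦p))))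
          g∈es , x∉g     = ∈-filter⁻ (x ∉?_) {xs = es} (∈-take⁻ 1 g∈)
          G              = All.lookup known g∈es
          q , q∈G , q∈f  = intersecting (e∈E G) f∈E
          y , y∈g , y↦q  = to G q∈G
          p≢q            = λ p≡q → x∉g (subst (_∈ g)
            (represents-unique y↦q (subst (Represents n x) p≡q x↦p)) y∈g)
      in unblocked x↦p p∈f y∈g y↦q q∈f (through-two {f} {p} {q} (progressive f∈E) p∈f q∈f p≢q) ok

  -- By `uncovered`, applied to vertices with the coordinates in `C`, it suffices to refute each
  -- edge missing them, which `step` does.
  wins-sound : ∀ {R} → Sound R → ∀ {n xs es C} .{{_ : NonZero n}} → Realised n xs → All (Realised n) es →
               ¬ T (wins R xs es C)
  wins-sound {R} R-sound {n} {xs} {es} {C} X known ok =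
    let small , ok′       = Equivalence.to T-∧ ok
        covering , ok″    = Equivalence.to T-∧ ok′
        known-C , blocked = Equivalence.to T-∧ ok″
        ps , length≡ , all-known , lookup = choose
          (All.map C-known (All.all⁺ (λ p → any (λ g → does (p ∈? g)) es) C known-C))
    in uncovered ps (subst (ℕ._≤ 3) (sym length≡) (T-does⁻ (length C ℕ.≤? 3) small)) all-known
      λ f f∈E miss → step R-sound X known
        (All.map (λ {g} t → Any.map (λ {p} → T-does⁻ (p ∈? g)) (any⁻ (λ p → does (p ∈? g)) C t))
          (All.all⁺ (λ g → any (λ p → does (p ∈? g)) C) es covering))
        (λ x∈C → let q , _ , x↦q = lookup x∈C in q , x↦q) blocked f f∈E
        λ {x} {p} x∈C x↦p p∈f → let q , q∈ps , x↦q = lookup x∈C in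
          miss q∈ps (subst f (represents-injective x↦p x↦q) p∈f)
    where
    C-known : ∀ {x} → T (any (λ g → does (x ∈? g)) es) → KnownPoint n x
    C-known {x} t =
      let g , g∈es , x∈g = find (any⁻ (λ g → does (x ∈? g)) es t)
          G              = All.lookup known g∈es
          p , p∈G , x↦p  = from G (T-does⁻ (x ∈? g) x∈g)
      in p , (e G , e∈E G , p∈G) , x↦p

  refutes-sound : ∀ ss → Sound (refutes ss)
  refutes-sound (s ∷ ss) {n} {es@(xs ∷ _)} known@(X ∷ _) ok =
    let C , _ , won = find (any⁻ (wins (refutes ss) xs es) (s es) ok)
    in wins-sound {refutes ss} (refutes-sound ss) {n} {xs} {es} {C} X known won

  not-refuted : ∀ ss {n es} .{{_ : NonZero n}} → All (Realised n) es → refutes ss es ≢ true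
  not-refuted ss known eq = refutes-sound ss known (subst T (sym eq) _)

-- Lines

level-along : ∀ ℓ p k d → level ℓ (p ⊕ k · d) ≡ level ℓ p + k * level ℓ d
level-along ℓ (x , y) k (z , w) = lemma (Line.a ℓ) (Line.b ℓ) x y k z w
  where
  lemma : ∀ a b x y k z w → a * (x + k * z) + b * (y + k * w) ≡ a * x + b * y + k * (a * z + b * w)
  lemma = solve-∀

direction-⊆ : ∀ ℓ {e : Pred Point 0ℓ} p d i → level ℓ p ≡ Line.c ℓ → level ℓ d ≡ 0ℤ →
              e ≐ (_∈ progression p d i) → e ⊆ integerPoints ℓ
direction-⊆ ℓ p d i p∈ℓ d∥ℓ (e⊆ , _) q∈e with ∈-progression⁻ p d i (e⊆ q∈e)
... | m , _ , refl = trans (level-along ℓ p (+ m - + i) d) (trans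
  (cong₂ (λ s t → s + (+ m - + i) * t) p∈ℓ d∥ℓ)
  (trans (cong (λ s → Line.c ℓ + s) (ℤ.*-zeroʳ (+ m - + i))) (ℤ.+-identityʳ (Line.c ℓ))))

direction-vanishes : ∀ ℓ {p d k} → k ≢ 0ℤ → level ℓ p ≡ Line.c ℓ →
                     level ℓ (p ⊕ k · d) ≡ Line.c ℓ → level ℓ d ≡ 0ℤ
direction-vanishes ℓ {p} {d} {k} k≢0 p∈ℓ q∈ℓ = [ (λ k≡0 → contradiction k≡0 k≢0) , id ]′
  (ℤ.i*j≡0⇒i≡0∨j≡0 k (trans (lemma (level ℓ p) (k * level ℓ d))
    (ℤ.i≡j⇒i-j≡0 {level ℓ p + k * level ℓ d} {level ℓ p}
      (trans (sym (level-along ℓ p k d)) (trans q∈ℓ (sym p∈ℓ))))))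
  where
  lemma : ∀ l s → s ≡ l + s - l
  lemma = solve-∀

through-⊆ : ∀ ℓ {p q e} → Through p q e → level ℓ p ≡ Line.c ℓ → level ℓ q ≡ Line.c ℓ →
            e ⊆ integerPoints ℓ
through-⊆ ℓ {p} (placedThrough {i} {c} k d _ ck≡12 refl e≐) p∈ℓ q∈ℓ =
  direction-⊆ ℓ p d i p∈ℓ (direction-vanishes ℓ {p} {d} {k} k≢0 p∈ℓ q∈ℓ) e≐
  where
  k≢0 : k ≢ 0ℤ
  k≢0 refl with () ← trans (sym (ℤ.*-zeroʳ (+ c))) ck≡12

-- A nonzero coordinate of `d` times the level of `d′` is a combination of the level of `d` and the
-- determinant, both zero.
parallel-vanishes : ∀ ℓ {d d′} → d ≢ (0ℤ , 0ℤ) → det d d′ ≡ 0ℤ → level ℓ d ≡ 0ℤ → level ℓ d′ ≡ 0ℤ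
parallel-vanishes ℓ {d₁ , d₂} {d₁′ , d₂′} d≢0 det≡0 d∥ℓ with d₁ ℤ.≟ 0ℤ | d₂ ℤ.≟ 0ℤ
... | yes refl | yes refl = contradiction refl d≢0
... | no d₁≢0  | _        = [ (λ eq → contradiction eq d₁≢0) , id ]′ (ℤ.i*j≡0⇒i≡0∨j≡0 d₁
  (trans (lemma (Line.a ℓ) (Line.b ℓ) d₁ d₂ d₁′ d₂′)
    (trans (cong₂ (λ s t → d₁′ * s + Line.b ℓ * t) d∥ℓ det≡0) (zeros d₁′ (Line.b ℓ)))))
  where
  lemma : ∀ a b d₁ d₂ d₁′ d₂′ →
          d₁ * (a * d₁′ + b * d₂′) ≡ d₁′ * (a * d₁ + b * d₂) + b * (d₁ * d₂′ - d₂ * d₁′)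
  lemma = solve-∀
  zeros : ∀ s t → s * 0ℤ + t * 0ℤ ≡ 0ℤ
  zeros = solve-∀
... | yes _ | no d₂≢0     = [ (λ eq → contradiction eq d₂≢0) , id ]′ (ℤ.i*j≡0⇒i≡0∨j≡0 d₂
  (trans (lemma (Line.a ℓ) (Line.b ℓ) d₁ d₂ d₁′ d₂′)
    (trans (cong₂ (λ s t → d₂′ * s - Line.a ℓ * t) d∥ℓ det≡0) (zeros d₂′ (Line.a ℓ)))))
  where
  lemma : ∀ a b d₁ d₂ d₁′ d₂′ →
          d₂ * (a * d₁′ + b * d₂′) ≡ d₂′ * (a * d₁ + b * d₂) - a * (d₁ * d₂′ - d₂ * d₁′)
  lemma = solve-∀
  zeros : ∀ s t → s * 0ℤ - t * 0ℤ ≡ 0ℤ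
  zeros = solve-∀

-- Evaluation of the search and the contradiction for covering numbers above 3

refutation : ∀ {i} → i ℕ.≤ 2 → refutes strategies (axis₁ ∷ axis₂ i ∷ []) ≡ true
-- The bound leaves three closed instances of the search, each of which evaluates to `true`.
refutation z≤n             = refl
refutation (s≤s z≤n)       = refl
refutation (s≤s (s≤s z≤n)) = refl

some-edge : ∀ (H : Hypergraph Point) → Intersecting H → ∃[ e ] e ∈ᵖ Hypergraph.E H
some-edge _ ((e ∷ [] , (e∈E ∷ [] , _) , _) , _) = e , e∈E

module _ (H : Hypergraph Point) (segments : IsSegmentHypergraph 5 H) (ν≡1 : Intersecting H)
         {τ} (covering : IsCoveringNumber H τ) (τ≰3 : ¬ τ ℕ.≤ 3) where
  open Hypergraph H
  open IsSegmentHypergraph segments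

  progressive : ∀ {e} → e ∈ᵖ E → IsProgression e
  progressive {e} e∈E = let ℓ , segment = consecutive e e∈E in isProgression ℓ segment

  intersecting : ∀ {e f} → e ∈ᵖ E → f ∈ᵖ E → e ≬ f
  intersecting {e} {f} e∈E f∈E = proj₂ (edge-isCover H segments ν≡1 e e∈E) f f∈E

  -- A progression through two different points of the line of `e` lies on that line, which carries
  -- only one edge.
  linear : ∀ {e f p q} → e ∈ᵖ E → f ∈ᵖ E → p ∈ᵖ e → p ∈ᵖ f →
           q ∈ᵖ e → q ∈ᵖ f → p ≢ q → e ≐ f
  linear {e} {f} e∈E f∈E p∈e p∈f q∈e q∈f p≢q =
    let ℓ , segment = consecutive e e∈E
        open ConsecutiveOn segment
    in oneEdgePerLine ℓ e f e∈E f∈E onLine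
         (through-⊆ ℓ (through-two (progressive f∈E) p∈f q∈f p≢q) (onLine p∈e) (onLine q∈e))

  -- Parallel steps from the common point `p` would put both edges on one line.
  independent : ∀ {e f p d d′ i} → e ∈ᵖ E → f ∈ᵖ E → d ≢ (0ℤ , 0ℤ) → e ≐ (_∈ progression p d 0) →
                f ≐ (_∈ progression p d′ i) → ¬ e ≐ f → det d d′ ≢ 0ℤ
  independent {e} {f} {p} {d} {d′} {i} e∈E f∈E d≢0 (_ , ⊆e) f≐ e≢f det≡0 =
    let ℓ , segment = consecutive e e∈E
        open ConsecutiveOn segment
        p∈ℓ = subst (λ q → level ℓ q ≡ Line.c ℓ) (⊕-zero p d 0ℤ) (onLine (⊆e (here refl)))
        d∥ℓ = direction-vanishes ℓ {p} {d} {1ℤ} (λ ()) p∈ℓ (onLine (⊆e (there (here refl))))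
    in e≢f (oneEdgePerLine ℓ e f e∈E f∈E onLine
         (direction-⊆ ℓ p d′ i p∈ℓ (parallel-vanishes ℓ {d} {d′} d≢0 det≡0 d∥ℓ) f≐))

  -- Otherwise `C` without repetitions is a cover of size at most 3. Finiteness of `C` and of the
  -- edges lets `meet` extract an actual common point.
  uncovered : ∀ C → length C ℕ.≤ 3 → All (λ p → ∃[ e ] e ∈ᵖ E × p ∈ᵖ e) C →
              ¬ (∀ f → f ∈ᵖ E → ¬ (∀ {p} → p ∈ C → ¬ p ∈ᵖ f))
  uncovered C small known hit = τ≰3 (ℕ.≤-trans
    (proj₂ covering (_∈ C) (length (deduplicate _≟ᵖ_ C))
      ((λ p∈C → let e , e∈E , p∈e = All.lookup known p∈C in E⊆2^V e e∈E p∈e) ,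
       λ f f∈E → meet size (ConsecutiveOn.size (proj₂ (consecutive f f∈E)))
         λ C⊥f → hit f f∈E λ p∈C p∈f → C⊥f (p∈C , p∈f))
      size)
    (ℕ.≤-trans (length-deduplicate _≟ᵖ_ C) small))
    where
    size : HasSize (_∈ C) (length (deduplicate _≟ᵖ_ C))
    size = deduplicate _≟ᵖ_ C , Unique.deduplicate-! _≟ᵖ_ C , refl , ∈-deduplicate⁺ _≟ᵖ_ , ∈-deduplicate⁻ _≟ᵖ_ C

  -- In the frame with origin `p` and basis `d`, `d′` the two edges become the axes from which the
  -- search starts.
  no-corner : ∀ {e f} p d d′ i → i ℕ.≤ 2 → e ∈ᵖ E → f ∈ᵖ E → d ≢ (0ℤ , 0ℤ) → ¬ e ≐ f →
              e ≐ (_∈ progression p d 0) → f ≐ (_∈ progression p d′ i) → ⊥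
  no-corner {e} {f} p d d′ i i≤2 e∈E f∈E d≢0 e≢f e≐ f≐ = not-refuted strategies {1ℤ} {axis₁ ∷ axis₂ i ∷ []}
      ( realised-axis (1ℤ , 0ℤ) 0 e∈E (subst (λ d → e ≐ (_∈ progression p d 0)) (sym combine-e₁) e≐)
      ∷ realised-axis (0ℤ , 1ℤ) i f∈E (subst (λ d → f ≐ (_∈ progression p d i)) (sym combine-e₂) f≐) ∷ [])
      (refutation i≤2)
    where
    det≢0 : det d d′ ≢ 0ℤ
    det≢0 = independent {p = p} {d} {d′} {i} e∈E f∈E d≢0 e≐ f≐ e≢f
    open Frame p d d′ det≢0
    open Soundness progressive intersecting linear uncovered p d d′ det≢0

  no-end : ∀ {e f} p d → e ∈ᵖ E → f ∈ᵖ E → d ≢ (0ℤ , 0ℤ) → ¬ e ≐ f →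
           e ≐ (_∈ progression p d 0) → ¬ p ∈ᵖ f
  no-end p d e∈E f∈E d≢0 e≢f e≐ p∈f =
    let d′ , i , _ , i≤2 , f≐ = pointed (progressive f∈E) p∈f
    in no-corner p d d′ i i≤2 e∈E f∈E d≢0 e≢f e≐ f≐

  module _ {e} (e∈E : e ∈ᵖ E) p d (d≢0 : d ≢ (0ℤ , 0ℤ)) (e≐ : e ≐ (_∈ progression p d 0)) where

    at : ℕ → Point
    at m = p ⊕ (+ m - + 0) · d

    at-∈ : ∀ m → m ℕ.< 5 → at m ∈ᵖ e
    at-∈ m m<5 = proj₂ e≐ (∈-progression⁺ p d 0 m<5)

    inner : List Point
    inner = at 1 ∷ at 2 ∷ at 3 ∷ []

    -- An edge missing the inner points would still meet `e`, hence at an end, against `no-end`;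
    -- reversal turns the last point into the first.
    inner-hit : ∀ f → f ∈ᵖ E → ¬ (∀ {q} → q ∈ inner → ¬ q ∈ᵖ f)
    inner-hit f f∈E miss =
      let q , q∈e , q∈f = intersecting e∈E f∈E
          m , m<5 , q≡  = ∈-progression⁻ p d 0 (proj₁ e≐ q∈e)
      in at-∉ m m<5 (subst f q≡ q∈f)
      where
      e≢f : ¬ e ≐ f
      e≢f (e⊆f , _) = miss (here refl) (e⊆f (at-∈ 1 (s≤s (s≤s z≤n))))
      at-∉ : ∀ m → m ℕ.< 5 → ¬ at m ∈ᵖ f
      at-∉ 0 _ = no-end (at 0) d e∈E f∈E d≢0 e≢f (subst (λ ps → e ≐ (_∈ ps)) (recentre p d 0 0) e≐)
      at-∉ 1 _ = miss (here refl)
      at-∉ 2 _ = miss (there (here refl))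
      at-∉ 3 _ = miss (there (there (here refl)))
      at-∉ 4 _ = no-end (at 4) (-1ℤ · d) e∈E f∈E (-1·≢0 d≢0) e≢f
        (≐-trans (subst (λ ps → e ≐ (_∈ ps)) (recentre p d 0 4) e≐) (reverse-≐ (at 4) d ℕ.≤-refl))
      at-∉ (suc (suc (suc (suc (suc _))))) (s≤s (s≤s (s≤s (s≤s (s≤s ())))))

    inner-uncovered : ⊥
    inner-uncovered = uncovered inner (s≤s (s≤s (s≤s z≤n)))
      ( (e , e∈E , at-∈ 1 (s≤s (s≤s z≤n))) ∷ (e , e∈E , at-∈ 2 (s≤s (s≤s (s≤s z≤n))))
      ∷ (e , e∈E , at-∈ 3 (s≤s (s≤s (s≤s (s≤s z≤n))))) ∷ []) inner-hit

  impossible : ⊥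
  impossible =
    let e , e∈E           = some-edge H ν≡1
        p , d , d≢0 , e≐ = progressive e∈E
    in inner-uncovered e∈E p d d≢0 e≐

theorem4p7 : (H : Hypergraph Point) → IsSegmentHypergraph 5 H →
    Intersecting H → (τ : ℕ) → IsCoveringNumber H τ → τ ≤ 3
theorem4p7 H segments ν≡1 τ covering =
  -- The comparison is decidable, so refuting its negation suffices.
  decidable-stable (τ ℕ.≤? 3) λ τ≰3 → impossible H segments ν≡1 covering τ≰3
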